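{- For each $n\ge1$ we have $$|\mathrm{Tree}_n|=|\mathrm{End}_n|\quad\text{and}\quad|\mathrm{Tree}^{\star}_n|=|\mathrm{Cay}_n|.$$
   Context: Write $[n]=\{1,\dots,n\}$. $\mathrm{End}_n$ is the set of endofunctions $x:[n]\to[n]$, and $\mathrm{Cay}_n$ (Cayley permutations of size $n$) is the set of those $x\in\mathrm{End}_n$ whose image is $[k]$ for some $k\le n$. A binary tree is either empty or a triple $T=(L,r,R)$ with $r$ a node (the root) and $L,R$ binary trees (left and right subtree). $V(T)$ is the set of nodes and the size of $T$ is $|V(T)|$. A vertex labeling is a map $\mathfrak{l}:V(T)\to\{1,2,\dots\}$; $\max(T)$ is the largest label, with $\max(\emptyset)=0$. Labeled binary trees are considered up to label-preserving isomorphism of binary trees. $T$ is decreasing if it is empty, or $T=(L,r,R)$ with $L,R$ decreasing and $\mathfrak{l}(r)\ge\max\{\max(L),\max(R)\}$. $T$ is strictly decreasing to the left if it is empty, or $T=(L,r,R)$ with $\mathfrak{l}(r)>\max(L)$ and $L,R$ strictly decreasing to the left. An endotree of size $n$ is a decreasing binary tree of size $n$ that is strictly decreasing to the left and has all labels in $[n]$; it is regular if the set of its labels equals $[k]$ for some $k\le n$. $\mathrm{Tree}_n$ is the set of endotrees of size $n$ and $\mathrm{Tree}^{\star}_n$ the set of regular endotrees of size $n$. -}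

module Defs where

open import Data.Empty using (⊥)
open import Data.Fin using (Fin; toℕ)
open import Data.Nat using (ℕ; suc; _⊔_; _≤_; _≥_; _>_)
open import Data.Product using (∃-syntax; _×_; proj₁)
open import Data.Refinement using (Refinement; value)
open import Data.Sum using (_⊎_; inj₁; inj₂)
open import Data.Tree.Binary using (Tree; leaf; node; #nodes)
open import Data.Unit using (⊤; tt)
open import Function using (_∘_; _⇔_; Inverse)
open import Level using (0ℓ)
open import Relation.Binary using (Setoid)
open import Relation.Binary.Construct.On as On using ()
open import Relation.Binary.PropositionalEquality
  using (_≡_; setoid; _→-setoid_)

-- Membership in [ k ] = {1, …, k}.
_∈[_] : ℕ → ℕ → Set
m ∈[ k ] = 1 ≤ m × m ≤ k

_HasImage[_] : {A : Set} → (A → ℕ) → ℕ → Set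
f HasImage[ k ] = ∀ m → (∃[ a ] f a ≡ m) ⇔ m ∈[ k ]

------------------------------------------------------------------------
-- Endofunctions and Cayley permutations

-- [ n ] is Fin n, where i : Fin n stands for the number suc (toℕ i).
-- Endofunctions are compared pointwise.
End : ℕ → Setoid 0ℓ 0ℓ
End n = Fin n →-setoid Fin n

IsCayley : ∀ n → (Fin n → Fin n) → Set
IsCayley n x = ∃[ k ] k ≤ n × (suc ∘ toℕ ∘ x) HasImage[ k ]

-- Elements are compared by their underlying endofunction only, so this is a
-- subset of End n: different proofs of IsCayley do not give new elements.
Cay : ℕ → Setoid 0ℓ 0ℓ
Cay n = On.setoid (End n) (proj₁ {B = IsCayley n})

------------------------------------------------------------------------
-- Labeled binary trees

-- Labels are positive integers; the proof of positivity is irrelevant.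
Label : Set
Label = Refinement ℕ (1 ≤_)

-- An element of this inductive type is a labeled binary tree up to
-- label-preserving isomorphism, and propositional equality of such elements
-- is equality of isomorphism classes.  The empty tree is leaf tt.
LabeledTree : Set
LabeledTree = Tree Label ⊤

V : LabeledTree → Set
V (leaf _)     = ⊥
V (node L r R) = V L ⊎ ⊤ ⊎ V R

label : (T : LabeledTree) → V T → ℕ
label (node L r R) (inj₁ v)         = label L v
label (node L r R) (inj₂ (inj₁ tt)) = value r
label (node L r R) (inj₂ (inj₂ v))  = label R v

max : LabeledTree → ℕ
max (leaf _)     = 0
max (node L r R) = value r ⊔ (max L ⊔ max R)

Decreasing : LabeledTree → Set
Decreasing (leaf _)     = ⊤
Decreasing (node L r R) =
  Decreasing L × Decreasing R × value r ≥ max L ⊔ max R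

StrictlyDecreasingLeft : LabeledTree → Set
StrictlyDecreasingLeft (leaf _)     = ⊤
StrictlyDecreasingLeft (node L r R) =
  StrictlyDecreasingLeft L × StrictlyDecreasingLeft R × value r > max L

record IsEndotree (n : ℕ) (T : LabeledTree) : Set where
  field
    size                   : #nodes T ≡ n
    decreasing             : Decreasing T
    strictlyDecreasingLeft : StrictlyDecreasingLeft T
    labels-in-range        : ∀ v → label T v ∈[ n ]

IsRegular : ℕ → LabeledTree → Set
IsRegular n T = ∃[ k ] k ≤ n × label T HasImage[ k ]

IsRegularEndotree : ℕ → LabeledTree → Set
IsRegularEndotree n T = IsEndotree n T × IsRegular n T

-- As for Cay, elements are compared by their underlying tree only.
Endotree : ℕ → Setoid 0ℓ 0ℓ
Endotree n = On.setoid (setoid LabeledTree) (proj₁ {B = IsEndotree n})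

RegularEndotree : ℕ → Setoid 0ℓ 0ℓ
RegularEndotree n =
  On.setoid (setoid LabeledTree) (proj₁ {B = IsRegularEndotree n})

------------------------------------------------------------------------
-- Cardinality of finite sets

HasCardinality : Setoid 0ℓ 0ℓ → ℕ → Set
HasCardinality S c = Inverse S (setoid (Fin c))

-- Both sets are finite, with the same number of elements.
∣_∣≡∣_∣ : Setoid 0ℓ 0ℓ → Setoid 0ℓ 0ℓ → Set
∣ S ∣≡∣ T ∣ = ∃[ c ] HasCardinality S c × HasCardinality T c

{-# OPTIONS --safe #-}
-- Reading the labels of a tree in in-order identifies endotrees of size n with
-- words of length n over [ n ], that is, with endofunctions: the tree is
-- recovered from its word by taking the leftmost maximum as the root.  The word
-- has the same letters as the tree has labels, so regular trees correspond to
-- Cayley permutations.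
module Submission where

open import Defs
open import Data.Fin using (Fin; zero; suc; toℕ; fromℕ<; funToFin; finToFun; combine)
open import Data.Fin.Properties
  using (toℕ-fromℕ<; toℕ-injective; toℕ<n; suc-injective;
         finToFun-funToFin; funToFin-finToFin; all?; any?)
open import Data.Irrelevant using ([_])
open import Data.List using (List; []; _∷_; _++_; foldr; length; tabulate)
open import Data.List.Properties
  using (foldr-++; length-++; length-tabulate; tabulate-cong; ∷-injective)
open import Data.List.Relation.Unary.All as All using (All; []; _∷_)
import Data.List.Relation.Unary.All.Properties as All
open import Data.List.Relation.Unary.Any as Any using (Any; here; there)
import Data.List.Relation.Unary.Any.Properties as Any
open import Data.Nat using (ℕ; zero; suc; pred; _+_; _^_; _⊔_; _≤_; _<_; _≥_; _>_; z≤n; s≤s)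
open import Data.Nat.Properties
  using (_≟_; _≤?_; _<?_; anyUpTo?; ≤-refl; ≤-trans; ≤-pred; <⇒≱; ≮⇒≥; <⇒≤;
         ⊔-lub; m⊔n≤o⇒m≤o; m⊔n≤o⇒n≤o; m≤m⊔n; m≤n⊔m; m≤n⇒m≤o⊔n)
open import Data.Product using (∃-syntax; _×_; _,_; proj₁; proj₂; map₂; uncurry)
open import Data.Refinement using (_,_; value)
open import Data.Refinement.Properties using (value-injective)
open import Data.Sum using (inj₁; inj₂)
open import Data.Tree.Binary using (leaf; node; #nodes)
open import Data.Unit using (tt)
open import Function using (_∘_; _⇔_; mk⇔; Inverse; Injection; Equivalence)
import Function.Construct.Composition as Composition
import Function.Construct.Symmetry as Symmetry
open import Function.Properties.Bijection using (Bijection⇒Inverse)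
open import Function.Properties.Inverse using (Inverse⇒Injection)
open import Level using (0ℓ)
open import Relation.Binary using (Setoid; _Respects_)
import Relation.Binary.Construct.On as On
open import Relation.Binary.PropositionalEquality
  using (_≡_; _≗_; refl; sym; trans; cong; cong₂; subst; setoid; module ≡-Reasoning)
open import Relation.Nullary using (Dec; yes; no; contradiction)
open import Relation.Nullary.Decidable using (map′; _×-dec_)
open import Relation.Unary using (Decidable)

-- Cardinalities of decidable subsets of finite sets.

Subset : (S : Setoid 0ℓ 0ℓ) → (Setoid.Carrier S → Set) → Setoid 0ℓ 0ℓ
Subset S P = On.setoid S (proj₁ {B = P})

injective-surjective⇒inverse : ∀ {S T : Setoid 0ℓ 0ℓ} → let module S = Setoid S; module T = Setoid T in
  (f : S.Carrier → T.Carrier) →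
  (∀ {x y} → x S.≈ y → f x T.≈ f y) →
  (∀ {x y} → f x T.≈ f y → x S.≈ y) →
  (∀ y → ∃[ x ] f x T.≈ y) →
  Inverse S T
injective-surjective⇒inverse {T = T} f f-cong f-injective f-surjective =
  Bijection⇒Inverse record
    { to        = f
    ; cong      = f-cong
    ; bijective = f-injective
                -- `bijective` asks about every `z` equivalent to the chosen preimage; congruence of
                -- `f` extends the equation from `x` to all such `z`.
                , λ y → map₂ (λ fx≈y z≈x → Setoid.trans T (f-cong z≈x) fx≈y) (f-surjective y)
    }

-- Induction on `c`: if `zero` belongs to the subset, it takes index `zero` and the indices of the
-- others shift up by one; otherwise the count of the remaining elements is kept.
finSubset-cardinality : ∀ c {P : Fin c → Set} → Decidable P →
  ∃[ d ] HasCardinality (Subset (setoid (Fin c)) P) d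
finSubset-cardinality zero P? =
  0 , injective-surjective⇒inverse (λ ()) (λ { {() , _} }) (λ { {() , _} }) (λ ())
finSubset-cardinality (suc c) {P} P? with finSubset-cardinality c (P? ∘ suc) | P? zero
... | d , I | yes p = suc d , injective-surjective⇒inverse f f-cong f-injective f-surjective
  where
  open Inverse I
  open Injection (Inverse⇒Injection I) using (injective)
  f : ∃[ i ] P i → Fin (suc d)
  f (zero  , _) = zero
  f (suc i , q) = suc (to (i , q))
  f-cong : ∀ {x y} → proj₁ x ≡ proj₁ y → f x ≡ f y
  f-cong {zero  , _} {zero   , _} _ = refl
  -- The two elements may carry different proofs of membership; `to-cong` still applies because only
  -- first components are compared.
  f-cong {suc i , _} {suc .i , _} refl = cong suc (to-cong refl)
  f-injective : ∀ {x y} → f x ≡ f y → proj₁ x ≡ proj₁ y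
  f-injective {zero  , _} {zero  , _} _ = refl
  f-injective {suc i , _} {suc j , _} e = cong suc (injective (suc-injective e))
  f-surjective : ∀ j → ∃[ x ] f x ≡ j
  f-surjective zero    = (zero , p) , refl
  f-surjective (suc j) = let (i , q) = from j in (suc i , q) , cong suc (strictlyInverseˡ j)
... | d , I | no ¬p = d , injective-surjective⇒inverse f f-cong f-injective f-surjective
  where
  open Inverse I
  open Injection (Inverse⇒Injection I) using (injective)
  f : ∃[ i ] P i → Fin d
  f (zero  , q) = contradiction q ¬p
  f (suc i , q) = to (i , q)
  f-cong : ∀ {x y} → proj₁ x ≡ proj₁ y → f x ≡ f y
  f-cong {zero  , q} = contradiction q ¬p
  f-cong {suc i , _} {suc .i , _} refl = to-cong refl
  f-injective : ∀ {x y} → f x ≡ f y → proj₁ x ≡ proj₁ y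
  f-injective {zero  , q} = contradiction q ¬p
  f-injective {suc i , _} {zero  , q} = contradiction q ¬p
  f-injective {suc i , _} {suc j , _} e = cong suc (injective e)
  f-surjective : ∀ j → ∃[ x ] f x ≡ j
  f-surjective j = let (i , q) = from j in (suc i , q) , strictlyInverseˡ j

-- The predicate is pulled back to `Fin c` along the bijection; since `from (to x)` is merely
-- equivalent to `x`, membership has to respect the equivalence.
subset-cardinality : ∀ {S c} {P : Setoid.Carrier S → Set} → HasCardinality S c →
  P Respects Setoid._≈_ S → Decidable P → ∃[ d ] HasCardinality (Subset S P) d
subset-cardinality {S} {c} {P} I resp P? =
  map₂ (Composition.inverse restricted) (finSubset-cardinality c (P? ∘ from))
  where
  open Inverse I
  open Injection (Inverse⇒Injection I) using (injective)
  module S = Setoid S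
  restricted : Inverse (Subset S P) (Subset (setoid (Fin c)) (P ∘ from))
  restricted = injective-surjective⇒inverse
    (λ (x , p) → to x , resp (S.sym (strictlyInverseʳ x)) p)
    to-cong injective
    (λ (i , p) → (from i , p) , strictlyInverseˡ i)

-- Counting endofunctions and deciding the Cayley condition.

funToFin-cong : ∀ {m n} {f g : Fin m → Fin n} → f ≗ g → funToFin f ≡ funToFin g
funToFin-cong {zero}  _   = refl
funToFin-cong {suc m} f≗g = cong₂ combine (f≗g zero) (funToFin-cong (f≗g ∘ suc))

End-cardinality : ∀ n → HasCardinality (End n) (n ^ n)
End-cardinality n = injective-surjective⇒inverse funToFin funToFin-cong
  (λ {f} {g} e i → trans (sym (finToFun-funToFin f i))
     (trans (cong (λ k → finToFun k i) e) (finToFun-funToFin g i)))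
  (λ k → finToFun k , funToFin-finToFin {n} k)

HasImage-transfer : ∀ {A B : Set} {f : A → ℕ} {g : B → ℕ} →
  (∀ m → (∃[ a ] f a ≡ m) ⇔ (∃[ b ] g b ≡ m)) →
  ∀ {k} → f HasImage[ k ] → g HasImage[ k ]
HasImage-transfer f⇔g h m = Composition.equivalence (Symmetry.equivalence (f⇔g m)) (h m)

IsCayley-resp : ∀ {n} {x y : Fin n → Fin n} → x ≗ y → IsCayley n x → IsCayley n y
IsCayley-resp x≗y (k , k≤n , h) = k , k≤n , HasImage-transfer (λ m → mk⇔
  (map₂ (trans (cong (suc ∘ toℕ) (sym (x≗y _)))))
  (map₂ (trans (cong (suc ∘ toℕ) (x≗y _))))) h

-- The quantifier over all naturals reduces to two finite searches: every value lies in the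
-- interval, and each of its `k` members is attained.
hasImage? : ∀ {n} (f : Fin n → ℕ) k → Dec (f HasImage[ k ])
hasImage? {n} f k = map′ ⇒ ⇐
  (all? (λ i → (1 ≤? f i) ×-dec (f i ≤? k)) ×-dec all? (λ j → any? (λ i → f i ≟ suc (toℕ j))))
  where
  ⇒ : (∀ i → f i ∈[ k ]) × (∀ (j : Fin k) → ∃[ i ] f i ≡ suc (toℕ j)) → f HasImage[ k ]
  ⇒ (within , onto) m = mk⇔ (λ { (i , refl) → within i }) attained
    where
    attained : ∀ {m} → m ∈[ k ] → ∃[ i ] f i ≡ m
    attained {suc m} (_ , m<k) =
      map₂ (λ e → trans e (cong suc (toℕ-fromℕ< m<k))) (onto (fromℕ< m<k))
  ⇐ : f HasImage[ k ] → (∀ i → f i ∈[ k ]) × (∀ (j : Fin k) → ∃[ i ] f i ≡ suc (toℕ j))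
  ⇐ h = (λ i → Equivalence.to (h (f i)) (i , refl))
      , (λ j → Equivalence.from (h (suc (toℕ j))) (s≤s z≤n , toℕ<n j))

isCayley? : ∀ n → Decidable (IsCayley n)
isCayley? n x = map′
  (λ (k , k<1+n , h) → k , ≤-pred k<1+n , h)
  (λ (k , k≤n , h) → k , s≤s k≤n , h)
  -- The search is strictly below its bound, so `suc n` is what admits `k = n`.
  (anyUpTo? (hasImage? (suc ∘ toℕ ∘ x)) (suc n))

-- In-order words of trees.

word : LabeledTree → List Label
word (leaf _)     = []
word (node L r R) = word L ++ r ∷ word R

length-word : ∀ T → length (word T) ≡ #nodes T
length-word (leaf _)     = refl
length-word (node L r R) = trans (length-++ (word L))
  (cong₂ (λ i j → i + suc j) (length-word L) (length-word R))

label⇔word : ∀ T m → (∃[ v ] label T v ≡ m) ⇔ Any (λ l → value l ≡ m) (word T)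
label⇔word T m = mk⇔ (uncurry (to T)) (from T)
  where
  to : ∀ T v → label T v ≡ m → Any (λ l → value l ≡ m) (word T)
  to (node L r R) (inj₁ v)         e = Any.++⁺ˡ (to L v e)
  to (node L r R) (inj₂ (inj₁ tt)) e = Any.++⁺ʳ (word L) (here e)
  to (node L r R) (inj₂ (inj₂ v))  e = Any.++⁺ʳ (word L) (there (to R v e))
  from : ∀ T → Any (λ l → value l ≡ m) (word T) → ∃[ v ] label T v ≡ m
  from (node L r R) a with Any.++⁻ (word L) a
  ... | inj₁ a′         = let (v , e) = from L a′ in inj₁ v , e
  ... | inj₂ (here e)   = inj₂ (inj₁ tt) , e
  ... | inj₂ (there a′) = let (v , e) = from R a′ in inj₂ (inj₂ v) , e

all-labels⇔all-letters : ∀ T (P : ℕ → Set) → (∀ v → P (label T v)) ⇔ All (P ∘ value) (word T)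
all-labels⇔all-letters T P = mk⇔
  (λ p → All.tabulate (λ l∈w →
     let (v , e) = Equivalence.from (label⇔word T _) (Any.map (cong value ∘ sym) l∈w)
     in subst P e (p v)))
  (λ ps v → let (q , e) = All.lookupAny ps (Equivalence.to (label⇔word T _) (v , refl))
            in subst P e q)

-- Rebuilding a valid tree from its word.

-- Prepends a letter to the in-order word: `x` descends the left spine past strictly larger labels
-- and takes what it then meets as its right subtree. On a tie `x` goes above, so the leftmost
-- maximum ends up as the root.
insert : Label → LabeledTree → LabeledTree
insert x (leaf _) = node (leaf tt) x (leaf tt)
insert x (node L r R) with value x <? value r
... | yes _ = node (insert x L) r R
... | no  _ = node (leaf tt) x (node L r R)

build : List Label → LabeledTree
build = foldr insert (leaf tt)

word-insert : ∀ x T → word (insert x T) ≡ x ∷ word T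
word-insert x (leaf _) = refl
word-insert x (node L r R) with value x <? value r
... | yes _ = cong (_++ r ∷ word R) (word-insert x L)
... | no  _ = refl

word-build : ∀ xs → word (build xs) ≡ xs
word-build []       = refl
word-build (x ∷ xs) = trans (word-insert x (build xs)) (cong (x ∷_) (word-build xs))

Valid : LabeledTree → Set
Valid T = Decreasing T × StrictlyDecreasingLeft T

-- Gives strictness at a node with empty left subtree, whose `max` is 0. The stored positivity proof
-- is irrelevant, so it is rebuilt by cases.
label-positive : (l : Label) → value l > 0
label-positive (suc _ , _) = s≤s z≤n
label-positive (zero , [ () ])

max-left : ∀ L r R → max L ≤ max (node L r R)
max-left L r R = m≤n⇒m≤o⊔n (value r) (m≤m⊔n (max L) (max R))

max-right : ∀ L r R → max R ≤ max (node L r R)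
max-right L r R = m≤n⇒m≤o⊔n (value r) (m≤n⊔m (max L) (max R))

-- Ensures that inserting `x` below a larger root keeps the left subtree strictly below that root.
max-insert : ∀ x T → max (insert x T) ≤ value x ⊔ max T
max-insert x (leaf _) = ≤-refl
max-insert x (node L r R) with value x <? value r
... | no  _   = ≤-refl
... | yes x<r = m≤n⇒m≤o⊔n (value x) (⊔-lub (m≤m⊔n (value r) _) (⊔-lub
  (≤-trans (max-insert x L)
    (⊔-lub (≤-trans (<⇒≤ x<r) (m≤m⊔n (value r) _)) (max-left L r R)))
  (max-right L r R)))

insert-valid : ∀ x T → Valid T → Valid (insert x T)
insert-valid x (leaf _) _ = (tt , tt , z≤n) , (tt , tt , label-positive x)
insert-valid x (node L r R) ((dL , dR , r≥) , (sL , sR , r>L)) with value x <? value r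
... | yes x<r =
  let (dL′ , sL′) = insert-valid x L (dL , sL)
      -- Here `suc` of a maximum computes to the maximum of the successors, so the two strict bounds
      -- combine by `⊔-lub`.
      L′<r = ≤-trans (s≤s (max-insert x L)) (⊔-lub x<r r>L)
  in (dL′ , dR , ⊔-lub (<⇒≤ L′<r) (m⊔n≤o⇒n≤o (max L) _ r≥)) , (sL′ , sR , L′<r)
... | no x≮r =
  (tt , (dL , dR , r≥) , ⊔-lub (≮⇒≥ x≮r) (≤-trans r≥ (≮⇒≥ x≮r))) ,
  (tt , (sL , sR , r>L) , label-positive x)

build-valid : ∀ xs → Valid (build xs)
build-valid []       = tt , tt
build-valid (x ∷ xs) = insert-valid x (build xs) (build-valid xs)

insert-left : ∀ {x r} → value x < value r → ∀ L R → insert x (node L r R) ≡ node (insert x L) r R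
insert-left {x} {r} x<r L R with value x <? value r
... | yes _   = refl
... | no  x≮r = contradiction x<r x≮r

insert-root : ∀ {x} T → value x ≥ max T → insert x T ≡ node (leaf tt) x T
insert-root (leaf _) _ = refl
insert-root {x} (node L r R) x≥ with value x <? value r
... | yes x<r = contradiction (m⊔n≤o⇒m≤o (value r) _ x≥) (<⇒≱ x<r)
... | no  _   = refl

-- Every letter is below the root `r`, so each insertion descends to the left and leaves `r` and `R`
-- untouched.
foldr-insert-left : ∀ {r} xs → All (λ x → value x < value r) xs → ∀ L R →
  foldr insert (node L r R) xs ≡ node (foldr insert L xs) r R
foldr-insert-left []       []           L R = refl
foldr-insert-left (x ∷ xs) (x<r ∷ xs<r) L R =
  trans (cong (insert x) (foldr-insert-left xs xs<r L R)) (insert-left x<r _ R)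

letters≤max : ∀ T → All (λ l → value l ≤ max T) (word T)
letters≤max (leaf _)     = []
letters≤max (node L r R) = All.++⁺
  (All.map (λ p → ≤-trans p (max-left L r R)) (letters≤max L))
  (m≤m⊔n (value r) _ ∷ All.map (λ p → ≤-trans p (max-right L r R)) (letters≤max R))

-- The fold works from the right. It first rebuilds `R`; then `r`, being at least `max R`, becomes a
-- root above all of `R`; the letters of `L`, strictly below `r`, finally assemble `L` in the empty
-- left subtree.
build-word : ∀ T → Valid T → build (word T) ≡ T
build-word (leaf tt) _ = refl
build-word (node L r R) ((dL , dR , r≥) , (sL , sR , r>L)) = begin
  build (word L ++ r ∷ word R)
    ≡⟨ foldr-++ insert (leaf tt) (word L) (r ∷ word R) ⟩
  foldr insert (insert r (build (word R))) (word L)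
    ≡⟨ cong (λ R′ → foldr insert (insert r R′) (word L)) (build-word R (dR , sR)) ⟩
  foldr insert (insert r R) (word L)
    ≡⟨ cong (λ T → foldr insert T (word L)) (insert-root R (m⊔n≤o⇒n≤o (max L) _ r≥)) ⟩
  foldr insert (node (leaf tt) r R) (word L)
    ≡⟨ foldr-insert-left (word L)
         (All.map (λ p → ≤-trans (s≤s p) r>L) (letters≤max L)) (leaf tt) R ⟩
  node (build (word L)) r R
    ≡⟨ cong (λ L′ → node L′ r R) (build-word L (dL , sL)) ⟩
  node L r R ∎
  where open ≡-Reasoning

-- Endofunctions as words.

letter : ∀ {n} → Fin n → Label
letter i = suc (toℕ i) , [ s≤s z≤n ]

letter-injective : ∀ {n} {i j : Fin n} → letter i ≡ letter j → i ≡ j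
letter-injective e = toℕ-injective (cong (pred ∘ value) e)

letters : ∀ {m n} → (Fin m → Fin n) → List Label
letters x = tabulate (letter ∘ x)

letters-cong : ∀ {m n} {x y : Fin m → Fin n} → x ≗ y → letters x ≡ letters y
letters-cong x≗y = tabulate-cong (cong letter ∘ x≗y)

letters-injective : ∀ {m n} {x y : Fin m → Fin n} → letters x ≡ letters y → x ≗ y
letters-injective e zero    = letter-injective (proj₁ (∷-injective e))
letters-injective e (suc i) = letters-injective (proj₂ (∷-injective e)) i

letters-surjective : ∀ {m n} xs → length xs ≡ m → All (λ l → value l ∈[ n ]) xs →
  ∃[ x ] letters {m} {n} x ≡ xs
letters-surjective [] refl [] = (λ ()) , refl
letters-surjective ((suc l , _) ∷ xs) refl ((_ , l<n) ∷ ps) =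
  let (x , e) = letters-surjective xs refl ps
  in  (λ { zero → fromℕ< l<n ; (suc i) → x i })
    -- A letter `suc l` comes from index `l`; its range bound `suc l ≤ n` is literally `l < n`.
    -- Equality of labels needs only equality of values.
    , cong₂ _∷_ (value-injective (cong suc (toℕ-fromℕ< l<n))) e

-- The bijections between trees and endofunctions.

module _ {n : ℕ} where

  endofunction : ∀ {T} → IsEndotree n T → ∃[ x ] letters {n} {n} x ≡ word T
  endofunction {T} E = letters-surjective (word T) (trans (length-word T) size)
    (Equivalence.to (all-labels⇔all-letters T (_∈[ n ])) labels-in-range)
    where open IsEndotree E

  build-endotree : (x : Fin n → Fin n) → IsEndotree n (build (letters x))
  build-endotree x = record
    { size = trans (sym (length-word (build (letters x))))
        (trans (cong length (word-build (letters x))) (length-tabulate (letter ∘ x)))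
    ; decreasing = proj₁ (build-valid (letters x))
    ; strictlyDecreasingLeft = proj₂ (build-valid (letters x))
    ; labels-in-range = Equivalence.from (all-labels⇔all-letters (build (letters x)) (_∈[ n ]))
        (subst (All _) (sym (word-build (letters x))) (All.tabulate⁺ (λ i → s≤s z≤n , toℕ<n (x i))))
    }

  -- `E` and `E′` may be different proofs for one tree, but both functions spell the same word,
  -- which determines them pointwise.
  endotree-cong : ∀ {T T′} (E : IsEndotree n T) (E′ : IsEndotree n T′) →
    T ≡ T′ → proj₁ (endofunction E) ≗ proj₁ (endofunction E′)
  endotree-cong E E′ refl = letters-injective
    (trans (proj₂ (endofunction E)) (sym (proj₂ (endofunction E′))))

  endotree-injective : ∀ {T T′} (E : IsEndotree n T) (E′ : IsEndotree n T′) →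
    proj₁ (endofunction E) ≗ proj₁ (endofunction E′) → T ≡ T′
  endotree-injective {T} {T′} E E′ x≗x′ = begin
    T               ≡⟨ build-word T (valid E) ⟨
    build (word T)  ≡⟨ cong build word≡word′ ⟩
    build (word T′) ≡⟨ build-word T′ (valid E′) ⟩
    T′              ∎
    where
    open ≡-Reasoning
    valid : ∀ {T} → IsEndotree n T → Valid T
    valid E = IsEndotree.decreasing E , IsEndotree.strictlyDecreasingLeft E
    word≡word′ : word T ≡ word T′
    word≡word′ = trans (sym (proj₂ (endofunction E)))
      (trans (letters-cong x≗x′) (proj₂ (endofunction E′)))

  endofunction-build : ∀ x → proj₁ (endofunction (build-endotree x)) ≗ x
  endofunction-build x = letters-injective
    (trans (proj₂ (endofunction (build-endotree x))) (word-build (letters x)))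

  image⇔labels : ∀ {T} {x : Fin n → Fin n} → letters x ≡ word T →
    ∀ m → (∃[ i ] suc (toℕ (x i)) ≡ m) ⇔ (∃[ v ] label T v ≡ m)
  image⇔labels {T} e m = Composition.equivalence
    (mk⇔ (λ (i , p) → subst (Any _) e (Any.tabulate⁺ i p))
         (λ a → Any.tabulate⁻ (subst (Any _) (sym e) a)))
    (Symmetry.equivalence (label⇔word T m))

  -- The function values and the tree labels form the same set of numbers, so the same `k` witnesses
  -- both conditions.
  regular⇔cayley : ∀ {T} {x : Fin n → Fin n} → letters x ≡ word T → IsRegular n T ⇔ IsCayley n x
  regular⇔cayley e = mk⇔
    (map₂ (map₂ (HasImage-transfer (Symmetry.equivalence ∘ image⇔labels e))))
    (map₂ (map₂ (HasImage-transfer (image⇔labels e))))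

  Endotree↔End : Inverse (Endotree n) (End n)
  Endotree↔End = injective-surjective⇒inverse
    (λ (_ , E) → proj₁ (endofunction E))
    (λ {(_ , E)} {(_ , E′)} → endotree-cong E E′)
    (λ {(_ , E)} {(_ , E′)} → endotree-injective E E′)
    (λ x → (_ , build-endotree x) , endofunction-build x)

  RegularEndotree↔Cay : Inverse (RegularEndotree n) (Cay n)
  RegularEndotree↔Cay = injective-surjective⇒inverse
    (λ (_ , E , r) → let (x , e) = endofunction E in x , Equivalence.to (regular⇔cayley e) r)
    (λ {(_ , E , _)} {(_ , E′ , _)} → endotree-cong E E′)
    (λ {(_ , E , _)} {(_ , E′ , _)} → endotree-injective E E′)
    (λ (x , c) →
      (_ , build-endotree x , Equivalence.from (regular⇔cayley (sym (word-build (letters x)))) c)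
      , endofunction-build x)

corollary2p4 : ∀ (n : ℕ) → n ≥ 1 →
    ∣ Endotree n ∣≡∣ End n ∣ × ∣ RegularEndotree n ∣≡∣ Cay n ∣
corollary2p4 n _ =
  (n ^ n , Composition.inverse Endotree↔End (End-cardinality n) , End-cardinality n) ,
  -- No formula for the number of Cayley permutations is needed: as a decidable subset of the
  -- `n ^ n` endofunctions they have some cardinality, and the bijection carries it over to regular
  -- endotrees.
  map₂ (λ I → Composition.inverse RegularEndotree↔Cay I , I)
    (subset-cardinality (End-cardinality n) IsCayley-resp (isCayley? n))
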